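{- Let $\mathcal{A}$ be a finite collection of hyperplanes in $\mathbb{R}^d$ with $\bigcap_{H\in\mathcal{A}}H=\{0\}$, and let $\mathcal{F}$ be the associated hyperplane face monoid. If $\mathcal{F}$ is non-trivial (has more than one element), then $\mathcal{F}$ is not Ramsey.
   Context: Hyperplane face monoid: for each $H\in\mathcal{A}$ let $H^+,H^-$ be the two open half-spaces determined by $H$ (with a fixed choice of which is which), and $H^0=H$. A face is a nonempty set of the form $A=\bigcap_{H\in\mathcal{A}}H^{\sigma_H(A)}$ with $\sigma_H(A)\in\{ -,+,0\}$; it is determined by its sign sequence $(\sigma_H(A))_{H\in\mathcal{A}}$. $\mathcal{F}$ is the set of all faces, with product $AB$ the face whose sign sequence is $\sigma_H(AB)=\sigma_H(A)$ if $\sigma_H(A)\neq 0$ and $\sigma_H(AB)=\sigma_H(B)$ if $\sigma_H(A)=0$. This is a monoid with identity $\{0\}$. Ramsey monoids: let $M$ be a finite monoid. A pointed $M$-set is a set $X$ with an action of $M$ and a distinguished point $x\in X$ such that $Mx=X$. Given a sequence $(X_n)_{n\in\mathbb{N}}$ of pointed $M$-sets, treated as mutually disjoint, let $\langle (X_n)\rangle$ be the set of all finite partial functions $f:\mathbb{N}\to\bigcup_n X_n$ with $f(n)\in X_n$ for all $n\in\operatorname{dom}(f)$. For $f,g\in\langle (X_n)\rangle$ write $f\prec g$ if $\max(\operatorname{dom}(f))<\min(\operatorname{dom}(g))$; in that case the product $fg$ is defined to be $f\cup g\in\langle (X_n)\rangle$. $M$ acts on $\langle (X_n)\rangle$ coordinatewise: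 $m(f)$ has the same domain as $f$ and $m(f)(n)=m\cdot f(n)$. The sequence $(X_n)$ has the Ramsey property if for every finite colouring of $\langle (X_n)\rangle$ there is a sequence $B=\{f_i\}_{i\in\mathbb{N}}\subseteq\langle (X_n)\rangle$ such that: (1) $f_i\prec f_{i+1}$ for all $i$; (2) for each $i$, the range of $f_i$ includes the distinguished element of $X_n$ for some $n\in\operatorname{dom}(f_i)$; (3) the set $[B]=\{m_0(f_{i_0})\cdots m_k(f_{i_k}) : k\in\mathbb{N},\ i_0<\dots<i_k,\ m_j\in M \text{ for all } j,\ m_j=1_M\text{ for at least one } j\}$ is monochromatic. $M$ is Ramsey if every sequence of pointed $M$-sets has the Ramsey property. -}

module Defs where

open import Algebra.Bundles using (CommutativeRing; Monoid)
open import Data.Fin.Base using (Fin; zero; suc)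
import Data.Fin.Base as Fin
import Data.Fin.Properties as Fin
open import Data.Maybe.Base as Maybe using (Maybe; just; nothing; _<∣>_)
open import Data.Maybe.Relation.Binary.Pointwise using (Pointwise)
open import Data.Maybe.Relation.Unary.Any as Any using ()
open import Data.Maybe using (Is-just)
open import Data.Nat.Base as ℕ using (ℕ; zero; suc)
import Data.Nat.Properties as ℕ
open import Data.Product.Base using (Σ; ∃; ∃₂; _×_; _,_; proj₁; proj₂)
open import Data.Rational.Base using (ℚ; 0ℚ; 1ℚ; ½)
import Data.Rational.Base as ℚ
import Data.Rational.Properties as ℚ
open import Data.Rational.Solver using (module +-*-Solver)
open import Data.Sum.Base using (inj₁; inj₂)
open import Data.Vec.Functional using (Vector)
open import Function.Base using (_∘_; _$_)
open import Function.Bundles using (Injection)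
open import Level using (0ℓ)
open import Relation.Binary.Bundles using (Setoid)
open import Relation.Binary.PropositionalEquality as ≡ using (_≡_; refl; sym; trans; cong; cong₂; subst)
open import Relation.Nullary using (¬_)
open import Relation.Unary using (Pred; _∈_; _≐_; Satisfiable)
import Relation.Binary.Reasoning.Setoid as SetoidReasoning

module DotProduct {c ℓ} (R : CommutativeRing c ℓ) where

  open CommutativeRing R
  open import Algebra.Properties.Ring ring using (-‿+-comm; -‿distribʳ-*)
  open import Algebra.Properties.Semiring.Sum semiring
    using (sum; sum-cong-≋; ∑-distrib-+; *-distribˡ-sum)
  open SetoidReasoning setoid

  dot : ∀ {d} → Vector Carrier d → Vector Carrier d → Carrier
  dot a x = sum λ i → a i * x i

  combination : ∀ {d} → Carrier → Vector Carrier d → Vector Carrier d → Vector Carrier d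
  combination t x y j = t * x j + y j

  dot-combination : ∀ {d} (a : Vector Carrier d) t x y →
                    t * dot a x + dot a y ≈ dot a (combination t x y)
  dot-combination a t x y = begin
    t * dot a x + dot a y
      ≈⟨ +-congʳ (*-distribˡ-sum t (λ j → a j * x j)) ⟩
    sum (λ j → t * (a j * x j)) + dot a y
      ≈⟨ ∑-distrib-+ (λ j → t * (a j * x j)) (λ j → a j * y j) ⟨
    sum (λ j → t * (a j * x j) + a j * y j)
      ≈⟨ sum-cong-≋ (λ j → term (a j) (x j) (y j)) ⟩
    dot a (combination t x y) ∎
    where
    term : ∀ α ξ η → t * (α * ξ) + α * η ≈ α * (t * ξ + η)
    term α ξ η = begin
      t * (α * ξ) + α * η   ≈⟨ +-congʳ (*-assoc t α ξ) ⟨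
      t * α * ξ + α * η     ≈⟨ +-congʳ (*-congʳ (*-comm t α)) ⟩
      α * t * ξ + α * η     ≈⟨ +-congʳ (*-assoc α t ξ) ⟩
      α * (t * ξ) + α * η   ≈⟨ distribˡ α (t * ξ) η ⟨
      α * (t * ξ + η)       ∎

  dot-combination-neg : ∀ {d} (a : Vector Carrier d) t x y →
                        t * (- dot a x) + - dot a y ≈ - dot a (combination t x y)
  dot-combination-neg a t x y = begin
    t * (- dot a x) + - dot a y   ≈⟨ +-congʳ (-‿distribʳ-* t (dot a x)) ⟨
    - (t * dot a x) + - dot a y   ≈⟨ -‿+-comm (t * dot a x) (dot a y) ⟩
    - (t * dot a x + dot a y)     ≈⟨ -‿cong (dot-combination a t x y) ⟩
    - dot a (combination t x y)   ∎

  dot-combination-zero : ∀ {d} (a : Vector Carrier d) t x y → dot a x ≈ 0# →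
                         dot a y ≈ dot a (combination t x y)
  dot-combination-zero a t x y p = begin
    dot a y                     ≈⟨ +-identityˡ (dot a y) ⟨
    0# + dot a y                ≈⟨ +-congʳ (zeroʳ t) ⟨
    t * 0# + dot a y            ≈⟨ +-congʳ (*-congˡ p) ⟨
    t * dot a x + dot a y       ≈⟨ dot-combination a t x y ⟩
    dot a (combination t x y)   ∎

  dot-zero : ∀ {d} (a : Vector Carrier d) → dot a (λ _ → 0#) ≈ 0#
  dot-zero a = begin
    sum (λ j → a j * 0#)   ≈⟨ sum-cong-≋ (λ j → *-comm (a j) 0#) ⟩
    sum (λ j → 0# * a j)   ≈⟨ *-distribˡ-sum 0# a ⟨
    0# * sum a             ≈⟨ zeroˡ (sum a) ⟩
    0#                     ∎

module Sequences where

  open import Data.Rational.Base hiding (_≃_)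
  open import Data.Rational.Properties
  open +-*-Solver using (solve; _:=_; _:+_; _:*_; _:-_; :-_)

  Eventually : Pred ℕ 0ℓ → Set
  Eventually P = ∃ λ N → ∀ n → N ℕ.≤ n → P n

  IsCauchy : Pred (ℕ → ℚ) 0ℓ
  IsCauchy u = ∀ ε → 0ℚ < ε → ∃ λ N → ∀ m n → N ℕ.≤ m → N ℕ.≤ n → ∣ u m - u n ∣ < ε

  Null : Pred (ℕ → ℚ) 0ℓ
  Null u = ∀ ε → 0ℚ < ε → Eventually λ n → ∣ u n ∣ < ε

  Bounded : Pred (ℕ → ℚ) 0ℓ
  Bounded u = ∃ λ K → 0ℚ < K × Eventually λ n → ∣ u n ∣ < K

  both : ∀ {P Q : Pred ℕ 0ℓ} → Eventually P → Eventually Q → Eventually λ n → P n × Q n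
  both (M , p) (N , q) = M ℕ.⊔ N , λ n h →
    p n (ℕ.≤-trans (ℕ.m≤m⊔n M N) h) , q n (ℕ.≤-trans (ℕ.m≤n⊔m M N) h)

  weaken : ∀ {P Q : Pred ℕ 0ℓ} → (∀ n → P n → Q n) → Eventually P → Eventually Q
  weaken f (N , p) = N , λ n h → f n (p n h)

  abstract

    half-pos : ∀ {ε} → 0ℚ < ε → 0ℚ < ½ * ε
    half-pos {ε} 0<ε = subst (_< ½ * ε) (*-zeroʳ ½) (*-monoʳ-<-pos ½ 0<ε)

    half+half : ∀ ε → ½ * ε + ½ * ε ≡ ε
    half+half ε = trans (sym (*-distribʳ-+ ε ½ ½)) (*-identityˡ ε)

    divide : ∀ {ε K} → 0ℚ < ε → 0ℚ < K → ∃ λ δ → 0ℚ < δ × K * δ ≡ ε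
    divide {ε} {K} 0<ε 0<K = 1/ K * ε , 0<δ , eq
      where
      instance
        K⁺ : Positive K
        K⁺ = positive 0<K
        K≢0 : NonZero K
        K≢0 = pos⇒nonZero K
        K⁻¹⁺ : Positive (1/ K)
        K⁻¹⁺ = 1/pos⇒pos K
      0<δ : 0ℚ < 1/ K * ε
      0<δ = subst (_< 1/ K * ε) (*-zeroʳ (1/ K)) (*-monoʳ-<-pos (1/ K) 0<ε)
      eq : K * (1/ K * ε) ≡ ε
      eq = trans (sym (*-assoc K (1/ K) ε)) (trans (cong (_* ε) (*-inverseʳ K)) (*-identityˡ ε))

    ∣+∣< : ∀ {a b p q} → ∣ a ∣ < p → ∣ b ∣ < q → ∣ a + b ∣ < p + q
    ∣+∣< {a} {b} a<p b<q = ≤-<-trans (∣p+q∣≤∣p∣+∣q∣ a b) (+-mono-< a<p b<q)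

    ∣*∣< : ∀ {a b p q} → 0ℚ < p → ∣ a ∣ < p → ∣ b ∣ < q → ∣ a * b ∣ < p * q
    ∣*∣< {a} {b} {p} {q} 0<p a<p b<q = subst (_< p * q) (sym (∣p*q∣≡∣p∣*∣q∣ a b))
      (≤-<-trans (*-monoʳ-≤-nonNeg ∣ b ∣ {{∣-∣-nonNeg b}} (<⇒≤ a<p))
                 (*-monoʳ-<-pos p {{positive 0<p}} b<q))

    ∣-∣< : ∀ {a b p} → - a ≡ b → ∣ a ∣ < p → ∣ b ∣ < p
    ∣-∣< {a} {p = p} eq = subst (_< p) (trans (sym (∣-p∣≡∣p∣ a)) (cong ∣_∣ eq))

    ∣≡∣< : ∀ {a b p} → a ≡ b → ∣ a ∣ < p → ∣ b ∣ < p
    ∣≡∣< {p = p} eq = subst (_< p) (cong ∣_∣ eq)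

    null-≡0 : ∀ {u} → (∀ n → u n ≡ 0ℚ) → Null u
    null-≡0 eq ε 0<ε = 0 , λ n _ → subst (_< ε) (cong ∣_∣ (sym (eq n))) 0<ε

    null-neg : ∀ {u v} → (∀ n → - u n ≡ v n) → Null u → Null v
    null-neg eq p ε 0<ε = weaken (λ n → ∣-∣< (eq n)) (p ε 0<ε)

    null-+ : ∀ {u v w} → (∀ n → u n + v n ≡ w n) → Null u → Null v → Null w
    null-+ eq p q ε 0<ε = weaken
      (λ n (a , b) → ∣≡∣< (eq n) (subst (_ <_) (half+half ε) (∣+∣< a b)))
      (both (p (½ * ε) (half-pos 0<ε)) (q (½ * ε) (half-pos 0<ε)))

    null-* : ∀ {u v w} → (∀ n → u n * v n ≡ w n) → Bounded u → Null v → Null w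
    null-* eq (K , 0<K , b) q ε 0<ε with divide 0<ε 0<K
    ... | δ , 0<δ , Kδ≡ε = weaken
      (λ n (x , y) → ∣≡∣< (eq n) (subst (_ <_) Kδ≡ε (∣*∣< 0<K x y)))
      (both b (q δ 0<δ))

    cauchy⇒bounded : ∀ {u} → IsCauchy u → Bounded u
    cauchy⇒bounded {u} c with c 1ℚ (positive⁻¹ 1ℚ)
    ... | N , h = 1ℚ + (1ℚ + ∣ u N ∣)
                , +-mono-<-≤ {0ℚ} {1ℚ} {0ℚ} (positive⁻¹ 1ℚ) (≤-trans (0≤∣p∣ (u N)) (<⇒≤ x<1+x))
                , N , λ n N≤n → ∣≡∣< (eq (u n) (u N)) (∣+∣< (h n N N≤n ℕ.≤-refl) x<1+x)
      where
      x<1+x : ∣ u N ∣ < 1ℚ + ∣ u N ∣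
      x<1+x = subst (_< 1ℚ + ∣ u N ∣) (+-identityˡ ∣ u N ∣) (+-monoˡ-< ∣ u N ∣ {0ℚ} {1ℚ} (positive⁻¹ 1ℚ))
      eq : ∀ a b → (a - b) + b ≡ a
      eq = solve 2 (λ a b → (a :- b) :+ b := a) refl

    cauchy-const : ∀ q → IsCauchy (λ _ → q)
    cauchy-const q ε 0<ε = 0 , λ _ _ _ _ → subst (_< ε) (cong ∣_∣ (sym (+-inverseʳ q))) 0<ε

    cauchy-neg : ∀ {u} → IsCauchy u → IsCauchy (λ n → - u n)
    cauchy-neg {u} c ε 0<ε with c ε 0<ε
    ... | N , h = N , λ m n p q → ∣-∣< (neg-distrib-+ (u m) (- u n)) (h m n p q)

    cauchy-+ : ∀ {u v} → IsCauchy u → IsCauchy v → IsCauchy (λ n → u n + v n)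
    cauchy-+ {u} {v} c d ε 0<ε with c (½ * ε) (half-pos 0<ε) | d (½ * ε) (half-pos 0<ε)
    ... | M , g | N , h = M ℕ.⊔ N , λ m n p q →
      ∣≡∣< (eq (u m) (u n) (v m) (v n)) (subst (_ <_) (half+half ε)
        (∣+∣< (g m n (l p) (l q)) (h m n (r p) (r q))))
      where
      l : ∀ {m} → M ℕ.⊔ N ℕ.≤ m → M ℕ.≤ m
      l = ℕ.≤-trans (ℕ.m≤m⊔n M N)
      r : ∀ {m} → M ℕ.⊔ N ℕ.≤ m → N ℕ.≤ m
      r = ℕ.≤-trans (ℕ.m≤n⊔m M N)
      eq : ∀ a b c d → (a - b) + (c - d) ≡ (a + c) - (b + d)
      eq = solve 4 (λ a b c d → (a :- b) :+ (c :- d) := (a :+ c) :- (b :+ d)) refl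

    *-difference : ∀ a b c d → a * (c - d) + d * (a - b) ≡ a * c - b * d
    *-difference = solve 4 (λ a b c d → a :* (c :- d) :+ d :* (a :- b) := a :* c :- b :* d) refl

    ∣*-difference∣< : ∀ a b c d {J K δ ε} → 0ℚ < J → 0ℚ < K → (J + K) * δ ≡ ε →
                      ∣ a ∣ < J → ∣ d ∣ < K → ∣ a - b ∣ < δ → ∣ c - d ∣ < δ →
                      ∣ a * c - b * d ∣ < ε
    ∣*-difference∣< a b c d {J} {K} {δ} {ε} 0<J 0<K eqδ a<J d<K a-b<δ c-d<δ =
      ≡.subst₂ (λ x y → ∣ x ∣ < y) (*-difference a b c d)
        (trans (sym (*-distribʳ-+ δ J K)) eqδ)
        (∣+∣< {a * (c - d)} {d * (a - b)} {J * δ} {K * δ}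
          (∣*∣< {a} {c - d} {J} {δ} 0<J a<J c-d<δ)
          (∣*∣< {d} {a - b} {K} {δ} 0<K d<K a-b<δ))

    cauchy-* : ∀ {u v} → IsCauchy u → IsCauchy v → IsCauchy (λ n → u n * v n)
    cauchy-* {u} {v} c d ε 0<ε = bounds (cauchy⇒bounded c) (cauchy⇒bounded d)
      where
      module _ (J K : ℚ) (0<J : 0ℚ < J) (0<K : 0ℚ < K)
               (A B : ℕ) (a : ∀ n → A ℕ.≤ n → ∣ u n ∣ < J) (b : ∀ n → B ℕ.≤ n → ∣ v n ∣ < K)
               (δ : ℚ) (eqδ : (J + K) * δ ≡ ε) where
        combine : (∃ λ N → ∀ m n → N ℕ.≤ m → N ℕ.≤ n → ∣ u m - u n ∣ < δ) →
                  (∃ λ N → ∀ m n → N ℕ.≤ m → N ℕ.≤ n → ∣ v m - v n ∣ < δ) →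
                  ∃ λ N → ∀ m n → N ℕ.≤ m → N ℕ.≤ n → ∣ u m * v m - u n * v n ∣ < ε
        combine (M , g) (N , h) = L , λ m n p q →
          ∣*-difference∣< (u m) (u n) (v m) (v n) 0<J 0<K eqδ
            (a m (lA p)) (b n (lB q)) (g m n (lM p) (lM q)) (h m n (lN p) (lN q))
          where
          L : ℕ
          L = (A ℕ.⊔ B) ℕ.⊔ (M ℕ.⊔ N)
          lA : ∀ {m} → L ℕ.≤ m → A ℕ.≤ m
          lA h = ℕ.≤-trans (ℕ.m≤m⊔n A B) (ℕ.≤-trans (ℕ.m≤m⊔n (A ℕ.⊔ B) (M ℕ.⊔ N)) h)
          lB : ∀ {m} → L ℕ.≤ m → B ℕ.≤ m
          lB h = ℕ.≤-trans (ℕ.m≤n⊔m A B) (ℕ.≤-trans (ℕ.m≤m⊔n (A ℕ.⊔ B) (M ℕ.⊔ N)) h)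
          lM : ∀ {m} → L ℕ.≤ m → M ℕ.≤ m
          lM h = ℕ.≤-trans (ℕ.m≤m⊔n M N) (ℕ.≤-trans (ℕ.m≤n⊔m (A ℕ.⊔ B) (M ℕ.⊔ N)) h)
          lN : ∀ {m} → L ℕ.≤ m → N ℕ.≤ m
          lN h = ℕ.≤-trans (ℕ.m≤n⊔m M N) (ℕ.≤-trans (ℕ.m≤n⊔m (A ℕ.⊔ B) (M ℕ.⊔ N)) h)
      bounds : Bounded u → Bounded v →
               ∃ λ N → ∀ m n → N ℕ.≤ m → N ℕ.≤ n → ∣ u m * v m - u n * v n ∣ < ε
      bounds (J , 0<J , A , a) (K , 0<K , B , b) =
        let (δ , 0<δ , eqδ) = divide {ε} {J + K} 0<ε (+-mono-< {0ℚ} {J} {0ℚ} {K} 0<J 0<K)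
        in combine J K 0<J 0<K A B a b δ eqδ (c δ 0<δ) (d δ 0<δ)

open Sequences using (Eventually; IsCauchy; Null)

-- The real numbers, as the setoid of Cauchy sequences of rationals.
record ℝ : Set where
  constructor mkℝ
  field
    seq    : ℕ → ℚ
    cauchy : IsCauchy seq

open ℝ public

infix  4 _≃_ _<_
infixl 6 _+_
infixl 7 _*_
infix  8 -_

record _≃_ (x y : ℝ) : Set where
  constructor mk≃
  field
    null : Null λ n → seq x n ℚ.- seq y n

record _<_ (x y : ℝ) : Set where
  constructor mk<
  field
    gap   : ℚ
    0<gap : 0ℚ ℚ.< gap
    below : Eventually λ n → gap ℚ.< seq y n ℚ.- seq x n

fromℚ : ℚ → ℝ
fromℚ q = mkℝ (λ _ → q) (Sequences.cauchy-const q)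

0ℝ 1ℝ : ℝ
0ℝ = fromℚ 0ℚ
1ℝ = fromℚ 1ℚ

_+_ _*_ : ℝ → ℝ → ℝ
x + y = mkℝ (λ n → seq x n ℚ.+ seq y n) (Sequences.cauchy-+ {seq x} {seq y} (cauchy x) (cauchy y))
x * y = mkℝ (λ n → seq x n ℚ.* seq y n) (Sequences.cauchy-* {seq x} {seq y} (cauchy x) (cauchy y))

-_ : ℝ → ℝ
- x = mkℝ (λ n → ℚ.- seq x n) (Sequences.cauchy-neg {seq x} (cauchy x))

module ℝ-Properties where

  open Sequences
  open +-*-Solver using (solve; _:=_; _:+_; _:*_; _:-_; :-_)

  pointwise : ∀ x y → (∀ n → seq x n ≡ seq y n) → x ≃ y
  pointwise x y eq = mk≃ $ null-≡0 λ n →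
    trans (cong (ℚ._- seq y n) (eq n)) (ℚ.+-inverseʳ (seq y n))

  ≃-refl : ∀ {x} → x ≃ x
  ≃-refl {x} = pointwise x x λ _ → refl

  ≃-sym : ∀ {x y} → x ≃ y → y ≃ x
  ≃-sym {x} {y} (mk≃ p) = mk≃ (null-neg (λ n → eq (seq x n) (seq y n)) p)
    where
    eq : ∀ a b → ℚ.- (a ℚ.- b) ≡ b ℚ.- a
    eq = solve 2 (λ a b → :- (a :- b) := b :- a) refl

  ≃-trans : ∀ {x y z} → x ≃ y → y ≃ z → x ≃ z
  ≃-trans {x} {y} {z} (mk≃ p) (mk≃ q) = mk≃ (null-+ (λ n → eq (seq x n) (seq y n) (seq z n)) p q)
    where
    eq : ∀ a b c → (a ℚ.- b) ℚ.+ (b ℚ.- c) ≡ a ℚ.- c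
    eq = solve 3 (λ a b c → (a :- b) :+ (b :- c) := a :- c) refl

  +-cong : ∀ {x y u v} → x ≃ y → u ≃ v → x + u ≃ y + v
  +-cong {x} {y} {u} {v} (mk≃ p) (mk≃ q) =
    mk≃ (null-+ (λ n → eq (seq x n) (seq y n) (seq u n) (seq v n)) p q)
    where
    eq : ∀ a b c d → (a ℚ.- b) ℚ.+ (c ℚ.- d) ≡ (a ℚ.+ c) ℚ.- (b ℚ.+ d)
    eq = solve 4 (λ a b c d → (a :- b) :+ (c :- d) := (a :+ c) :- (b :+ d)) refl

  -‿cong : ∀ {x y} → x ≃ y → - x ≃ - y
  -‿cong {x} {y} (mk≃ p) = mk≃ (null-neg (λ n → ℚ.neg-distrib-+ (seq x n) (ℚ.- seq y n)) p)

  *-cong : ∀ {x y u v} → x ≃ y → u ≃ v → x * u ≃ y * v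
  *-cong {x} {y} {u} {v} (mk≃ p) (mk≃ q) = mk≃ $ null-+
    {λ n → seq u n ℚ.* (seq x n ℚ.- seq y n)} {λ n → seq y n ℚ.* (seq u n ℚ.- seq v n)}
    (λ n → eq (seq x n) (seq y n) (seq u n) (seq v n))
    (null-* {seq u} {λ n → seq x n ℚ.- seq y n} (λ _ → refl) (cauchy⇒bounded {seq u} (cauchy u)) p)
    (null-* {seq y} {λ n → seq u n ℚ.- seq v n} (λ _ → refl) (cauchy⇒bounded {seq y} (cauchy y)) q)
    where
    eq : ∀ a b c d → c ℚ.* (a ℚ.- b) ℚ.+ b ℚ.* (c ℚ.- d) ≡ a ℚ.* c ℚ.- b ℚ.* d
    eq = solve 4 (λ a b c d → c :* (a :- b) :+ b :* (c :- d) := a :* c :- b :* d) refl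

  commutativeRing : CommutativeRing 0ℓ 0ℓ
  commutativeRing = record
    { Carrier = ℝ ; _≈_ = _≃_ ; _+_ = _+_ ; _*_ = _*_ ; -_ = -_ ; 0# = 0ℝ ; 1# = 1ℝ
    ; isCommutativeRing = record
      { isRing = record
        { +-isAbelianGroup = record
          { isGroup = record
            { isMonoid = record
              { isSemigroup = record
                { isMagma = record
                  { isEquivalence = record
                    { refl = ≃-refl
                    ; sym = ≃-sym
                    ; trans = ≃-trans }
                  ; ∙-cong = +-cong }
                ; assoc = λ x y z → pointwise (x + y + z) (x + (y + z))
                    λ n → ℚ.+-assoc (seq x n) (seq y n) (seq z n) }
              ; identity = (λ x → pointwise (0ℝ + x) x λ n → ℚ.+-identityˡ (seq x n))
                         , (λ x → pointwise (x + 0ℝ) x λ n → ℚ.+-identityʳ (seq x n)) }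
            ; inverse = (λ x → pointwise (- x + x) 0ℝ λ n → ℚ.+-inverseˡ (seq x n))
                      , (λ x → pointwise (x + - x) 0ℝ λ n → ℚ.+-inverseʳ (seq x n))
            ; ⁻¹-cong = -‿cong }
          ; comm = λ x y → pointwise (x + y) (y + x) λ n → ℚ.+-comm (seq x n) (seq y n) }
        ; *-cong = *-cong
        ; *-assoc = λ x y z → pointwise (x * y * z) (x * (y * z))
            λ n → ℚ.*-assoc (seq x n) (seq y n) (seq z n)
        ; *-identity = (λ x → pointwise (1ℝ * x) x λ n → ℚ.*-identityˡ (seq x n))
                     , (λ x → pointwise (x * 1ℝ) x λ n → ℚ.*-identityʳ (seq x n))
        ; distrib = (λ x y z → pointwise (x * (y + z)) (x * y + x * z)
                       λ n → ℚ.*-distribˡ-+ (seq x n) (seq y n) (seq z n))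
                  , (λ x y z → pointwise ((y + z) * x) (y * x + z * x)
                       λ n → ℚ.*-distribʳ-+ (seq x n) (seq y n) (seq z n)) }
      ; *-comm = λ x y → pointwise (x * y) (y * x) λ n → ℚ.*-comm (seq x n) (seq y n) } }

  -p≤∣p∣ : ∀ p → ℚ.- p ℚ.≤ ℚ.∣ p ∣
  -p≤∣p∣ p = subst (ℚ.- p ℚ.≤_) (ℚ.∣-p∣≡∣p∣ p) (p≤∣p∣ (ℚ.- p))
    where
    p≤∣p∣ : ∀ q → q ℚ.≤ ℚ.∣ q ∣
    p≤∣p∣ q@record{} with ℚ.≤-total 0ℚ q
    ... | inj₁ 0≤q = ℚ.≤-reflexive (sym (ℚ.0≤p⇒∣p∣≡p 0≤q))
    ... | inj₂ q≤0 = ℚ.≤-trans q≤0 (ℚ.0≤∣p∣ q)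

  ∣p∣<k⇒-k<p : ∀ {p k} → ℚ.∣ p ∣ ℚ.< k → ℚ.- k ℚ.< p
  ∣p∣<k⇒-k<p {p} {k} h = subst (ℚ.- k ℚ.<_) (neg-neg p)
    (ℚ.neg-antimono-< (ℚ.≤-<-trans (-p≤∣p∣ p) h))
    where
    neg-neg : ∀ p → ℚ.- (ℚ.- p) ≡ p
    neg-neg = solve 1 (λ p → :- (:- p) := p) refl

  <-resp-≃ : ∀ {x y u v} → x ≃ u → y ≃ v → x < y → u < v
  <-resp-≃ {x} {y} {u} {v} p (mk≃ q) (mk< ε 0<ε h) = mk< δ 0<δ (weaken step (both h (d δ 0<δ)))
    where
    δ = ½ ℚ.* ε
    0<δ = half-pos 0<ε
    d : Null λ n → (seq v n ℚ.- seq u n) ℚ.- (seq y n ℚ.- seq x n)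
    d = null-neg (λ n → eq (seq x n) (seq y n) (seq u n) (seq v n))
          (null-+ (λ _ → refl) (_≃_.null (≃-sym p)) q)
      where
      eq : ∀ a b c d → ℚ.- ((c ℚ.- a) ℚ.+ (b ℚ.- d)) ≡ (d ℚ.- c) ℚ.- (b ℚ.- a)
      eq = solve 4 (λ a b c d → :- ((c :- a) :+ (b :- d)) := (d :- c) :- (b :- a)) refl
    step : ∀ n → ε ℚ.< seq y n ℚ.- seq x n ×
           ℚ.∣ (seq v n ℚ.- seq u n) ℚ.- (seq y n ℚ.- seq x n) ∣ ℚ.< δ →
           δ ℚ.< seq v n ℚ.- seq u n
    step n (a , b) = ≡.subst₂ ℚ._<_
      (trans (cong (ℚ._+ ℚ.- δ) (sym (half+half ε))) (eq₁ δ))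
      (eq₂ (seq y n ℚ.- seq x n) (seq v n ℚ.- seq u n))
      (ℚ.+-mono-< a (∣p∣<k⇒-k<p b))
      where
      eq₁ : ∀ d → d ℚ.+ d ℚ.+ ℚ.- d ≡ d
      eq₁ = solve 1 (λ d → d :+ d :+ :- d := d) refl
      eq₂ : ∀ a b → a ℚ.+ (b ℚ.- a) ≡ b
      eq₂ = solve 2 (λ a b → a :+ (b :- a) := b) refl

  neg-< : ∀ {x} → x < 0ℝ → 0ℝ < - x
  neg-< {x} (mk< ε 0<ε h) =
    mk< ε 0<ε (weaken (λ n → subst (ε ℚ.<_) (ℚ.+-comm 0ℚ (ℚ.- seq x n))) h)

  neg-<⁻¹ : ∀ {x} → 0ℝ < - x → x < 0ℝ
  neg-<⁻¹ {x} (mk< ε 0<ε h) =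
    mk< ε 0<ε (weaken (λ n → subst (ε ℚ.<_) (ℚ.+-comm (ℚ.- seq x n) 0ℚ)) h)

  scaled-bound : ∀ {δ K t₀ t a b} → 0ℚ ℚ.< δ → 0ℚ ℚ.< t₀ → δ ℚ.* t₀ ≡ 1ℚ ℚ.+ K → t₀ ℚ.≤ t →
                 δ ℚ.< a ℚ.- 0ℚ → ℚ.∣ b ∣ ℚ.< K → 1ℚ ℚ.< (t ℚ.* a ℚ.+ b) ℚ.- 0ℚ
  scaled-bound {δ} {K} {t₀} {t} {a} {b} 0<δ 0<t₀ eq t₀≤t p q =
    ≡.subst₂ ℚ._<_ (eq₁ 1ℚ K) (sym (ℚ.+-identityʳ (t ℚ.* a ℚ.+ b)))
      (ℚ.+-mono-< {1ℚ ℚ.+ K} {t ℚ.* a} {ℚ.- K} {b} (ℚ.≤-<-trans le lt) (∣p∣<k⇒-k<p q))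
    where
    eq₁ : ∀ p q → p ℚ.+ q ℚ.+ ℚ.- q ≡ p
    eq₁ = solve 2 (λ p q → p :+ q :+ :- q := p) refl
    le : 1ℚ ℚ.+ K ℚ.≤ δ ℚ.* t
    le = subst (ℚ._≤ δ ℚ.* t) eq
      (ℚ.*-monoˡ-≤-nonNeg δ {{ℚ.pos⇒nonNeg δ {{ℚ.positive 0<δ}}}} t₀≤t)
    lt : δ ℚ.* t ℚ.< t ℚ.* a
    lt = subst (ℚ._< t ℚ.* a) (ℚ.*-comm t δ)
      (ℚ.*-monoʳ-<-pos t {{ℚ.positive (ℚ.<-≤-trans 0<t₀ t₀≤t)}}
        (subst (δ ℚ.<_) (ℚ.+-identityʳ a) p))

  dominates : ∀ {a} b → 0ℝ < a → ∃ λ t₀ → ∀ t → t₀ ℚ.≤ t → 0ℝ < fromℚ t * a + b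
  dominates {a} b (mk< δ 0<δ h) = bound (cauchy⇒bounded {seq b} (cauchy b))
    where
    Goal : Set
    Goal = ∃ λ t₀ → ∀ t → t₀ ℚ.≤ t → 0ℝ < fromℚ t * a + b
    bound : Bounded (seq b) → Goal
    bound (K , 0<K , k) = scale (divide {1ℚ ℚ.+ K} {δ} 0<1+K 0<δ)
      where
      0<1+K : 0ℚ ℚ.< 1ℚ ℚ.+ K
      0<1+K = ℚ.+-mono-< {0ℚ} {1ℚ} {0ℚ} {K} (ℚ.positive⁻¹ 1ℚ) 0<K
      scale : (∃ λ t₀ → 0ℚ ℚ.< t₀ × δ ℚ.* t₀ ≡ 1ℚ ℚ.+ K) → Goal
      scale (t₀ , 0<t₀ , eq) = t₀ , λ t t₀≤t → mk< 1ℚ (ℚ.positive⁻¹ 1ℚ)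
        (weaken (λ n (p , q) → scaled-bound {δ} {K} {t₀} {t} {seq a n} {seq b n} 0<δ 0<t₀ eq t₀≤t p q)
          (both h k))

module ℝ-DotProduct = DotProduct ℝ-Properties.commutativeRing

infix 7 _·_

_·_ : ∀ {d} → Vector ℝ d → Vector ℝ d → ℝ
_·_ = ℝ-DotProduct.dot

-- The affine hyperplane { x | normal · x = offset }. Replacing the pair
-- (normal, offset) by its negative exchanges the two open half-spaces.
record Hyperplane (d : ℕ) : Set where
  field
    normal   : Vector ℝ d
    offset   : ℝ
    normal≄0 : ¬ (∀ i → normal i ≃ 0ℝ)

data Sign : Set where
  neg zer pos : Sign

infix 9 _^_

_^_ : ∀ {d} → Hyperplane d → Sign → Pred (Vector ℝ d) 0ℓ
(H ^ neg) x = let open Hyperplane H in normal · x < offset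
(H ^ zer) x = let open Hyperplane H in normal · x ≃ offset
(H ^ pos) x = let open Hyperplane H in offset < normal · x

Origin : ∀ {d} → Pred (Vector ℝ d) 0ℓ
Origin x = ∀ j → x j ≃ 0ℝ

-- Finite collections are indexed by Fin n. Repetitions are allowed; they do
-- not affect the face monoid.
⋂ : ∀ {d n} → Vector (Hyperplane d) n → Pred (Vector ℝ d) 0ℓ
⋂ 𝒜 x = ∀ i → x ∈ 𝒜 i ^ zer

cell : ∀ {d n} → Vector (Hyperplane d) n → Vector Sign n → Pred (Vector ℝ d) 0ℓ
cell 𝒜 σ x = ∀ i → x ∈ 𝒜 i ^ σ i

infixr 7 _▸_

_▸_ : Sign → Sign → Sign
zer ▸ t = t
neg ▸ _ = neg
pos ▸ _ = pos

-- Finiteness is an injection into some Fin k, which classically is the usual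
-- notion; an enumeration would require deciding which cells are nonempty.
record FiniteMonoid : Set₁ where
  field
    monoid : Monoid 0ℓ 0ℓ
  open Monoid monoid public
  field
    finite : ∃ λ k → Injection setoid (≡.setoid (Fin k))

NonTrivial : FiniteMonoid → Set
NonTrivial M = ∃₂ λ a b → ¬ (a ≈ b)
  where open FiniteMonoid M

module FaceMonoid {d n : ℕ} (𝒜 : Vector (Hyperplane d) n) (⋂𝒜≐0 : ⋂ 𝒜 ≐ Origin) where

  record Face : Set where
    field
      sign     : Vector Sign n
      nonempty : Satisfiable (cell 𝒜 sign)

  open Face

  infix 4 _≈_

  _≈_ : Face → Face → Set
  A ≈ B = ∀ i → sign A i ≡ sign B i

  module R = CommutativeRing ℝ-Properties.commutativeRing
  open ℝ-Properties
  open Hyperplane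

  0ᵥ : Vector ℝ d
  0ᵥ _ = 0ℝ

  combination : ℚ → Vector ℝ d → Vector ℝ d → Vector ℝ d
  combination t = ℝ-DotProduct.combination (fromℚ t)

  0∈ : ∀ i → 0ᵥ ∈ 𝒜 i ^ zer
  0∈ = proj₂ ⋂𝒜≐0 {0ᵥ} λ j → R.refl

  offset≃0 : ∀ i → offset (𝒜 i) ≃ 0ℝ
  offset≃0 i = R.trans (R.sym (0∈ i)) (ℝ-DotProduct.dot-zero (normal (𝒜 i)))

  -- t x + y lies in the product of the faces of x and y once t is large.
  product-∈ : ∀ i s s′ x y → x ∈ 𝒜 i ^ s → y ∈ 𝒜 i ^ s′ →
              ∃ λ t₀ → ∀ t → t₀ ℚ.≤ t → combination t x y ∈ 𝒜 i ^ (s ▸ s′)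
  product-∈ i s s′ x y = go s
    where
    a = normal (𝒜 i)
    b = offset (𝒜 i)
    b≃0 : b ≃ 0ℝ
    b≃0 = offset≃0 i
    0≃b : 0ℝ ≃ b
    0≃b = R.sym b≃0
    value : ∀ t → fromℚ t * (a · x) + a · y ≃ a · combination t x y
    value t = ℝ-DotProduct.dot-combination a (fromℚ t) x y
    negated : ∀ t → fromℚ t * (- (a · x)) + - (a · y) ≃ - (a · combination t x y)
    negated t = ℝ-DotProduct.dot-combination-neg a (fromℚ t) x y
    same : a · x ≃ b → ∀ t → a · y ≃ a · combination t x y
    same p t = ℝ-DotProduct.dot-combination-zero a (fromℚ t) x y (R.trans p b≃0)
    go : ∀ s → x ∈ 𝒜 i ^ s → y ∈ 𝒜 i ^ s′ →
         ∃ λ t₀ → ∀ t → t₀ ℚ.≤ t → combination t x y ∈ 𝒜 i ^ (s ▸ s′)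
    go pos p _ =
      let (t₀ , h) = dominates (a · y) (<-resp-≃ b≃0 R.refl p)
      in t₀ , λ t le → <-resp-≃ 0≃b (value t) (h t le)
    go neg p _ =
      let (t₀ , h) = dominates (- (a · y)) (neg-< (<-resp-≃ R.refl b≃0 p))
      in t₀ , λ t le → <-resp-≃ R.refl 0≃b (neg-<⁻¹ (<-resp-≃ R.refl (negated t) (h t le)))
    go zer p q = 0ℚ , λ t _ → move s′ t q
      where
      move : ∀ s t → y ∈ 𝒜 i ^ s → combination t x y ∈ 𝒜 i ^ s
      move neg t = <-resp-≃ (same p t) R.refl
      move zer t = R.trans (R.sym (same p t))
      move pos t = <-resp-≃ R.refl (same p t)

  uniform : ∀ {k} {P : Fin k → ℚ → Set} →
            (∀ i → ∃ λ t₀ → ∀ t → t₀ ℚ.≤ t → P i t) → ∃ λ t → ∀ i → P i t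
  uniform {k} {P} h = proj₁ (common k (proj₁ ∘ h)) , λ i →
      proj₂ (h i) _ (proj₂ (common k (proj₁ ∘ h)) i)
    where
    common : ∀ k (b : Fin k → ℚ) → ∃ λ t → ∀ i → b i ℚ.≤ t
    common zero    b = 0ℚ , λ ()
    common (suc k) b =
      let (t , q) = common k (b ∘ suc)
      in b zero ℚ.⊔ t , λ { zero    → ℚ.p≤p⊔q (b zero) t
                          ; (suc i) → ℚ.≤-trans (q i) (ℚ.p≤q⊔p (b zero) t) }

  ▸-assoc : ∀ s t u → (s ▸ t) ▸ u ≡ s ▸ (t ▸ u)
  ▸-assoc neg _ _ = refl
  ▸-assoc zer _ _ = refl
  ▸-assoc pos _ _ = refl

  ▸-identityʳ : ∀ s → s ▸ zer ≡ s
  ▸-identityʳ neg = refl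
  ▸-identityʳ zer = refl
  ▸-identityʳ pos = refl

  code : Sign → Fin 3
  code neg = zero
  code zer = suc zero
  code pos = suc (suc zero)

  code-injective : ∀ s t → code s ≡ code t → s ≡ t
  code-injective neg neg _ = refl
  code-injective zer zer _ = refl
  code-injective pos pos _ = refl

  funToFin-cong : ∀ {m k} {f g : Fin m → Fin k} → (∀ i → f i ≡ g i) →
                  Fin.funToFin f ≡ Fin.funToFin g
  funToFin-cong {zero}  eq = refl
  funToFin-cong {suc m} eq = cong₂ Fin.combine (eq zero) (funToFin-cong (eq ∘ suc))

  _∙_ : Face → Face → Face
  A ∙ B = record
    { sign     = λ i → sign A i ▸ sign B i
    ; nonempty =
        let (x , x∈A) = nonempty A
            (y , y∈B) = nonempty B
            (t , h)   = uniform λ i → product-∈ i (sign A i) (sign B i) x y (x∈A i) (y∈B i)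
        in combination t x y , h
    }

  ε : Face
  ε = record { sign = λ _ → zer ; nonempty = 0ᵥ , 0∈ }

  faceMonoid : FiniteMonoid
  faceMonoid = record
    { monoid = record
      { Carrier = Face ; _≈_ = _≈_ ; _∙_ = _∙_ ; ε = ε
      ; isMonoid = record
        { isSemigroup = record
          { isMagma = record
            { isEquivalence = record
              { refl = λ _ → refl
              ; sym = λ p i → sym (p i)
              ; trans = λ p q i → trans (p i) (q i) }
            ; ∙-cong = λ p q i → cong₂ _▸_ (p i) (q i) }
          ; assoc = λ A B C i → ▸-assoc (sign A i) (sign B i) (sign C i) }
        ; identity = (λ A i → refl) , (λ A i → ▸-identityʳ (sign A i)) } }
    ; finite = 3 ℕ.^ n , record
      { to = λ A → Fin.funToFin (code ∘ sign A)
      ; cong = λ p → funToFin-cong (λ i → cong code (p i))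
      ; injective = λ {A} {B} p i → code-injective (sign A i) (sign B i)
          (trans (sym (Fin.finToFun-funToFin (code ∘ sign A) i))
            (trans (cong (λ k → Fin.finToFun k i) p) (Fin.finToFun-funToFin (code ∘ sign B) i))) } }

open FaceMonoid public using (faceMonoid)

module RamseyMonoid (M : FiniteMonoid) where

  open FiniteMonoid M using (ε; _∙_) renaming (Carrier to |M|; _≈_ to _≈ᴹ_)

  record PointedSet : Set₁ where
    infixr 7 _▷_
    field
      setoid : Setoid 0ℓ 0ℓ
    open Setoid setoid public using (Carrier; _≈_)
    field
      _▷_        : |M| → Carrier → Carrier
      ▷-cong     : ∀ {a b x y} → a ≈ᴹ b → x ≈ y → a ▷ x ≈ b ▷ y
      ▷-identity : ∀ x → ε ▷ x ≈ x
      ▷-assoc    : ∀ a b x → (a ∙ b) ▷ x ≈ a ▷ (b ▷ x)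
      point      : Carrier
      generated  : ∀ x → ∃ λ a → a ▷ point ≈ x

  module _ (X : ℕ → PointedSet) where

    open PointedSet

    record PartialFunction : Set where
      field
        at : ∀ n → Maybe (Carrier (X n))

      dom : Pred ℕ 0ℓ
      dom n = Is-just (at n)

      field
        finite : ∃ λ b → ∀ n → n ∈ dom → n ℕ.< b

    open PartialFunction

    _≈ₚ_ : PartialFunction → PartialFunction → Set
    f ≈ₚ g = ∀ n → Pointwise (_≈_ (X n)) (at f n) (at g n)

    IsMax IsMin : Pred ℕ 0ℓ → ℕ → Set
    IsMax P a = a ∈ P × (∀ n → n ∈ P → n ℕ.≤ a)
    IsMin P a = a ∈ P × (∀ n → n ∈ P → a ℕ.≤ n)

    _≺_ : PartialFunction → PartialFunction → Set
    f ≺ g = ∃₂ λ a b → IsMax (dom f) a × IsMin (dom g) b × a ℕ.< b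

    -- Made total by preferring f on a common domain, which is empty when f ≺ g.
    _∪_ : PartialFunction → PartialFunction → PartialFunction
    f ∪ g = record
      { at     = λ n → at f n <∣> at g n
      ; finite = proj₁ (finite f) ℕ.⊔ proj₁ (finite g) , λ n →
          bound n (at f n) (proj₂ (finite f) n) (proj₂ (finite g) n)
      }
      where
      bound : ∀ n (p : Maybe (Carrier (X n))) {q a b} →
              (Is-just p → n ℕ.< a) → (Is-just q → n ℕ.< b) → Is-just (p <∣> q) → n ℕ.< a ℕ.⊔ b
      bound n (just _) {a = a} {b} h _ j = ℕ.≤-trans (h j) (ℕ.m≤m⊔n a b)
      bound n nothing  {a = a} {b} _ h j = ℕ.≤-trans (h j) (ℕ.m≤n⊔m a b)

    _⊙_ : |M| → PartialFunction → PartialFunction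
    m ⊙ f = record
      { at     = λ n → Maybe.map (_▷_ (X n) m) (at f n)
      ; finite = proj₁ (finite f) , λ n → bound n (at f n) (proj₂ (finite f) n)
      }
      where
      bound : ∀ n (p : Maybe (Carrier (X n))) {b} →
              (Is-just p → n ℕ.< b) → Is-just (Maybe.map (_▷_ (X n) m) p) → n ℕ.< b
      bound n (just _) h (Any.just _) = h (Any.just _)

    ⋃ : ∀ k → (Fin (suc k) → PartialFunction) → PartialFunction
    ⋃ zero    f = f zero
    ⋃ (suc k) f = f zero ∪ ⋃ k (f ∘ suc)

    [_] : (ℕ → PartialFunction) → Pred PartialFunction 0ℓ
    [ B ] g = ∃ λ k → Σ (Fin (suc k) → ℕ) λ i → Σ (Fin (suc k) → |M|) λ m →
      (∀ {p q} → p Fin.< q → i p ℕ.< i q) ×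
      (∃ λ j → m j ≈ᴹ ε) ×
      g ≈ₚ ⋃ k (λ j → m j ⊙ B (i j))

    RamseyProperty : Set
    RamseyProperty =
      ∀ r (χ : PartialFunction → Fin r) → (∀ {f g} → f ≈ₚ g → χ f ≡ χ g) →
      ∃ λ (B : ℕ → PartialFunction) →
        (∀ i → B i ≺ B (suc i)) ×
        (∀ i → ∃ λ n → Pointwise (_≈_ (X n)) (at (B i) n) (just (point (X n)))) ×
        (∃ λ c → ∀ f → f ∈ [ B ] → χ f ≡ c)

  Ramsey : Set₁
  Ramsey = ∀ X → RamseyProperty X

open RamseyMonoid public using (Ramsey)

{-# OPTIONS --safe #-}
-- If A is a face with nonzero sign on some hyperplane H, then so is its
-- opposite -A, and left multiplication by A (or by -A) overwrites every sign on
-- H by σ_H(A) (or by -σ_H(A)). Colour a finite partial function into the monoid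
-- by the sign on H of its value at the least point of its domain. For any
-- sequence B, both A(f₁)f₂ and (-A)(f₁)f₂ belong to [B], and their colours differ.
module Submission where

open import Data.Empty using (⊥-elim)
open import Data.Fin.Base using (Fin; zero; suc; toℕ)
open import Data.Maybe.Base as Maybe using (Maybe; just; nothing; _<∣>_; fromMaybe)
open import Data.Maybe using (Is-just)
open import Data.Maybe.Properties using (<∣>-identityʳ)
open import Data.Maybe.Relation.Binary.Pointwise as Pointwise using (Pointwise; just; nothing)
import Data.Maybe.Relation.Unary.Any as Any
open import Data.Nat.Base using (ℕ; zero; suc; s≤s; _≤_; _≤′_; _⊔_; ≤′-refl; ≤′-step)
import Data.Nat.Base as ℕ
open import Data.Nat.Properties using (≤-refl; ≤-trans; <-trans; ≤-<-trans; <⇒≱; n≤1+n; m≤m⊔n; m≤n⊔m; ≤⇒≤′; ≤′⇒≤)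
open import Data.Product.Base using (∃; _,_; proj₁; proj₂)
open import Data.Unit.Base using (tt)
open import Data.Vec.Functional using (Vector)
open import Function.Base using (_∘_)
open import Relation.Binary.PropositionalEquality using (_≡_; _≢_; _≗_; refl; sym; trans; cong; cong₂; subst)
open import Relation.Nullary using (¬_; contradiction)
open import Relation.Unary using (_≐_; _∈_)
open import Defs

-- Searches only below the bound. Since `<∣>` prefers its left argument, the least defined index
-- wins.
leading : ∀ {A : Set} → ℕ → (ℕ → Maybe A) → Maybe A
leading zero    u = nothing
leading (suc b) u = leading b u <∣> u b

module _ {A : Set} where

  leading-cong : ∀ b {u v : ℕ → Maybe A} → u ≗ v → leading b u ≡ leading b v
  leading-cong zero    u≗v = refl
  leading-cong (suc b) u≗v = cong₂ _<∣>_ (leading-cong b u≗v) (u≗v b)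

  leading-extend : ∀ {b b′} (u : ℕ → Maybe A) → (∀ n → b ≤ n → u n ≡ nothing) →
                   b ≤′ b′ → leading b′ u ≡ leading b u
  leading-extend u none ≤′-refl = refl
  leading-extend {b′ = suc b′} u none (≤′-step b≤b′)
    rewrite none b′ (≤′⇒≤ b≤b′) =
    trans (<∣>-identityʳ (leading b′ u)) (leading-extend u none b≤b′)

  -- Equal partial functions may carry different bounds, and the colouring must not see the
  -- difference. Both searches agree with the one up to `b ⊔ b′`.
  leading-unique : ∀ {b b′} {u v : ℕ → Maybe A} → u ≗ v →
                   (∀ n → b ≤ n → u n ≡ nothing) → (∀ n → b′ ≤ n → v n ≡ nothing) →
                   leading b u ≡ leading b′ v
  leading-unique {b} {b′} {u} {v} u≗v u-none v-none =
    trans (sym (leading-extend u u-none (≤⇒≤′ (m≤m⊔n b b′))))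
      (trans (leading-cong (b ⊔ b′) u≗v) (leading-extend v v-none (≤⇒≤′ (m≤n⊔m b b′))))

  leading-nothing : ∀ n (u : ℕ → Maybe A) → (∀ m → m ℕ.< n → u m ≡ nothing) →
                    leading n u ≡ nothing
  leading-nothing zero    u none = refl
  leading-nothing (suc n) u none
    rewrite leading-nothing n u (λ m m<n → none m (≤-trans m<n (n≤1+n n))) = none n ≤-refl

  leading-just : ∀ {n b x} (u : ℕ → Maybe A) → (∀ m → m ℕ.< n → u m ≡ nothing) →
                 u n ≡ just x → suc n ≤′ b → leading b u ≡ just x
  leading-just {n} u none at-n ≤′-refl rewrite leading-nothing n u none = at-n
  leading-just u none at-n (≤′-step n<b) rewrite leading-just u none at-n n<b = refl

¬Is-just⇒nothing : ∀ {A : Set} (p : Maybe A) → ¬ Is-just p → p ≡ nothing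
¬Is-just⇒nothing (just _) ¬j = contradiction (Any.just tt) ¬j
¬Is-just⇒nothing nothing  _  = refl

Is-just⇒just : ∀ {A : Set} {p : Maybe A} → Is-just p → ∃ λ x → p ≡ just x
Is-just⇒just {p = just x} _ = x , refl

module _ (M : FiniteMonoid) where

  open FiniteMonoid M using (_∙_; assoc; identityˡ; identityʳ; ∙-cong)
    renaming (Carrier to |M|; _≈_ to _≈ᴹ_; ε to e; setoid to setoidᴹ; refl to reflᴹ)
  open RamseyMonoid M using (PointedSet; PartialFunction; module PartialFunction; _≈ₚ_; _⊙_; ⋃; [_])
  open PartialFunction

  regular : PointedSet
  regular = record
    { setoid = setoidᴹ ; _▷_ = _∙_ ; ▷-cong = ∙-cong ; ▷-identity = identityˡ
    ; ▷-assoc = assoc ; point = e ; generated = λ x → x , identityʳ x }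

  module _ {r} (φ : |M| → Fin r) (φ-cong : ∀ {x y} → x ≈ᴹ y → φ x ≡ φ y) where

    X : ℕ → PointedSet
    X _ = regular

    PF : Set
    PF = PartialFunction X

    values : PF → ℕ → Maybe (Fin r)
    values f n = Maybe.map φ (at f n)

    values-beyond : ∀ f n → proj₁ (finite f) ≤ n → values f n ≡ nothing
    values-beyond f n b≤n = cong (Maybe.map φ)
      (¬Is-just⇒nothing (at f n) λ n∈f → <⇒≱ (proj₂ (finite f) n n∈f) b≤n)

    -- The default `c` is reached only when the domain is empty.
    leadingColour : Fin r → PF → Fin r
    leadingColour c f = fromMaybe c (leading (proj₁ (finite f)) (values f))

    leadingColour-cong : ∀ c f g → _≈ₚ_ X f g → leadingColour c f ≡ leadingColour c g
    leadingColour-cong c f g f≈g = cong (fromMaybe c)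
      (leading-unique (λ n → map-cong (f≈g n)) (values-beyond f) (values-beyond g))
      where
      map-cong : ∀ {p q} → Pointwise _≈ᴹ_ p q → Maybe.map φ p ≡ Maybe.map φ q
      map-cong (just x≈y) = cong just (φ-cong x≈y)
      map-cong nothing    = refl

    leadingColour-min : ∀ c f {n x} → (∀ m → m ℕ.< n → at f m ≡ nothing) → at f n ≡ just x →
                        leadingColour c f ≡ φ x
    leadingColour-min c f {n} none at-n = cong (fromMaybe c)
      (leading-just (values f) (λ m m<n → cong (Maybe.map φ) (none m m<n))
        (cong (Maybe.map φ) at-n)
        (≤⇒≤′ (proj₂ (finite f) n (subst Is-just (sym at-n) (Any.just tt)))))

    -- `φ` is constant on each of the right ideals `aM` and `bM`. The coefficient of the first block
    -- puts the leading value of a word into one ideal or the other, whatever `B` is.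
    ¬Ramsey : ∀ a b {s t} → (∀ x → φ (a ∙ x) ≡ s) → (∀ x → φ (b ∙ x) ≡ t) → s ≢ t → ¬ Ramsey M
    ¬Ramsey a b {s} {t} φa φb s≢t ramsey
      with ramsey X r (leadingColour s) (λ {f} {g} → leadingColour-cong s f g)
    ... | B , B≺ , _ , c , mono
      with B≺ 0 | B≺ 1
    -- `l` and `h` are the minimum and maximum of the domain of `B 1`, and `l′` is the minimum of
    -- the domain of `B 2`.
    ... | _ , l , _ , (l∈B₁ , l-min) , _ | h , l′ , (_ , h-max) , (_ , l′-min) , h<l′
      with Is-just⇒just l∈B₁
    ... | x , at-l = s≢t (trans (sym (colour a φa)) (trans (mono (word a) (member a))
                       (trans (sym (mono (word b) (member b))) (colour b φb))))
      where
      coefficient : |M| → Fin 2 → |M|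
      coefficient m zero       = m
      coefficient m (suc zero) = e

      -- Start at f₁ rather than f₀ because min (dom f₁) is provided by f₀ ≺ f₁.
      word : |M| → PF
      word m = ⋃ X 1 λ j → _⊙_ X (coefficient m j) (B (suc (toℕ j)))

      member : ∀ m → word m ∈ [_] X B
      -- The second block supplies the identity coefficient that `[ B ]` demands, which leaves `m`
      -- arbitrary on the first.
      member m = 1 , suc ∘ toℕ , coefficient m , s≤s , (suc zero , reflᴹ)
               , λ _ → Pointwise.refl reflᴹ

      colour : ∀ m {u} → (∀ x → φ (m ∙ x) ≡ u) → leadingColour s (word m) ≡ u
      colour m φm = trans (leadingColour-min s (word m) below at-min) (φm x)
        where
        below : ∀ n → n ℕ.< l → at (word m) n ≡ nothing
        below n n<l
          rewrite ¬Is-just⇒nothing (at (B 1) n) (λ n∈B₁ → <⇒≱ n<l (l-min n n∈B₁))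
                -- Here `n < l ≤ h < l′`.
                | ¬Is-just⇒nothing (at (B 2) n) (λ n∈B₂ →
                    <⇒≱ (<-trans n<l (≤-<-trans (h-max l l∈B₁) h<l′)) (l′-min n n∈B₂)) = refl
        at-min : at (word m) l ≡ just (m ∙ x)
        at-min rewrite at-l = refl

opposite : Sign → Sign
opposite neg = pos
opposite zer = zer
opposite pos = neg

module _ {d n : ℕ} (𝒜 : Vector (Hyperplane d) n) (⋂𝒜≐0 : ⋂ 𝒜 ≐ Origin) where

  open FaceMonoid 𝒜 ⋂𝒜≐0 hiding (faceMonoid)
  open Face
  open ℝ-Properties using (<-resp-≃; neg-<; neg-<⁻¹)
  open Hyperplane
  open import Algebra.Properties.Ring R.ring using (-1*x≈-x; -0#≈0#; -‿involutive)

  -- Negation is written as a combination with the zero vector so that `dot-combination` computes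
  -- its dot products.
  antipode : Vector ℝ d → Vector ℝ d
  antipode x = ℝ-DotProduct.combination (- 1ℝ) x 0ᵥ

  dot-antipode : ∀ a x → - (a · x) ≃ a · antipode x
  dot-antipode a x = R.trans (R.sym (R.+-identityʳ _))
    (R.trans (R.+-cong (R.sym (-1*x≈-x (a · x))) (R.sym (ℝ-DotProduct.dot-zero a)))
      (ℝ-DotProduct.dot-combination a (- 1ℝ) x 0ᵥ))

  -- Every hyperplane contains the origin, so its offset vanishes and negating `a · x` exchanges its
  -- two sides.
  antipode-∈ : ∀ i s x → x ∈ 𝒜 i ^ s → antipode x ∈ 𝒜 i ^ opposite s
  antipode-∈ i s x = go s
    where
    a = normal (𝒜 i)
    b≃0 = offset≃0 i
    go : ∀ s → x ∈ 𝒜 i ^ s → antipode x ∈ 𝒜 i ^ opposite s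
    go neg p = <-resp-≃ (R.sym b≃0) (dot-antipode a x) (neg-< (<-resp-≃ R.refl b≃0 p))
    go zer p = R.trans (R.sym (dot-antipode a x))
      (R.trans (R.-‿cong (R.trans p b≃0)) (R.trans -0#≈0# (R.sym b≃0)))
    -- `neg-<⁻¹` is applied to `- (a · x)`, whence the double negation.
    go pos p = <-resp-≃ (dot-antipode a x) (R.sym b≃0)
      (neg-<⁻¹ (<-resp-≃ b≃0 (R.sym (-‿involutive (a · x))) p))

  -ᶠ_ : Face → Face
  -ᶠ A = record
    { sign     = opposite ∘ sign A
    ; nonempty = antipode (proj₁ (nonempty A))
               , λ i → antipode-∈ i (sign A i) _ (proj₂ (nonempty A) i) }

  -- Handles `pos` and `neg` at once: `s` and `opposite s` are left zeros of `▸`, so the sign at `i`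
  -- is constant on the right ideals of `A` and `-ᶠ A`. Signs are coded because colours lie in some
  -- `Fin r`.
  ¬Ramsey-opposite : ∀ A i {s} → sign A i ≡ s → code s ≢ code (opposite s) →
                     (∀ t → s ▸ t ≡ s) → (∀ t → opposite s ▸ t ≡ opposite s) →
                     ¬ Ramsey (faceMonoid 𝒜 ⋂𝒜≐0)
  ¬Ramsey-opposite A i refl s≢-s fix fix′ =
    ¬Ramsey _ (λ F → code (sign F i)) (λ p → cong code (p i)) A (-ᶠ A)
      (λ F → cong code (fix (sign F i))) (λ F → cong code (fix′ (sign F i))) s≢-s

  Ramsey⇒sign≡zer : Ramsey (faceMonoid 𝒜 ⋂𝒜≐0) → ∀ A i → sign A i ≡ zer
  Ramsey⇒sign≡zer ramsey A i with sign A i in eq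
  ... | zer = refl
  ... | pos = ⊥-elim (¬Ramsey-opposite A i eq (λ ()) (λ _ → refl) (λ _ → refl) ramsey)
  ... | neg = ⊥-elim (¬Ramsey-opposite A i eq (λ ()) (λ _ → refl) (λ _ → refl) ramsey)

corollary5p3 : (d n : ℕ) (𝒜 : Vector (Hyperplane d) n) (⋂𝒜≐0 : ⋂ 𝒜 ≐ Origin) → NonTrivial (faceMonoid 𝒜 ⋂𝒜≐0) → ¬ Ramsey (faceMonoid 𝒜 ⋂𝒜≐0)
corollary5p3 d n 𝒜 ⋂𝒜≐0 (A , B , A≉B) ramsey =
  -- Both faces would equal `ε`, so no hyperplane on which they differ has to be found.
  A≉B λ i → trans (Ramsey⇒sign≡zer 𝒜 ⋂𝒜≐0 ramsey A i) (sym (Ramsey⇒sign≡zer 𝒜 ⋂𝒜≐0 ramsey B i))
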